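{- Let $D$ be a strongly connected digraph, let $k\ge 1$ be an integer, and suppose that the $k$-iterated line digraph $L^kD$ has minimum in-degree $\delta^-\ge 2$. Then: (i) If $k\ge 2$, then $L^kD$ admits a $(1,\le 2)$-identifying code. (ii) If $k=1$ and $\delta^-\ge 3$, then $LD$ admits a $(1,\le 2)$-identifying code. (iii) If $D$ is a 2-in-regular digraph and $k\ge 1$, then $L^kD$ admits a $(1,\le 2)$-identifying code if and only if there do not exist vertices $x,y,x',y'\in V(L^kD)$ with $x'\ne x$, $y'\neq y$ such that $N^-(x)=\{y,y'\}$, $N^-(y)=\{x,x'\}$ and $N^-(x')\cap N^-(y')\ne\emptyset$ (in-neighbourhoods taken in $L^kD$).
   Context: Digraphs are finite, without loops or multiple arcs; digons (both arcs $(u,v)$ and $(v,u)$) are allowed. $N^-(u)$ and $N^+(u)$ are the in- and out-neighbourhoods, $N^-[u]=\{u\}\cup N^-(u)$, $N^+[u]=\{u\}\cup N^+(u)$, and $N^{\pm}[U]=\bigcup_{u\in U}N^{\pm}[u]$. A digraph is 2-in-regular if every vertex has in-degree 2. The line digraph $LD$ of $D$ has vertex set the arc set of $D$, and a vertex $uv$ (for the arc $(u,v)$) is adjacent to $wz$ if and only if $v=w$. Set $L^0D=D$ and $L^kD=L(L^{k-1}D)$. For an integer $\ell\ge1$, a $(1,\le\ell)$-identifying code in a digraph $G$ is a set $C\subseteq V(G)$ that is dominating ($N^+[C]=V(G)$) and such that $N^-[X]\cap C\ne N^-[Y]\cap C$ for all distinct $X,Y\subseteq V(G)$ with $1\le|X|,|Y|\le\ell$.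 $G$ admits a $(1,\le \ell)$-identifying code if one exists; equivalently, if $N^-[X]\neq N^-[Y]$ for all such distinct $X,Y$. -}

module Defs where

open import Data.Bool using (Bool; T; T?)
open import Data.Fin using (Fin; _≟_)
open import Data.Fin.Properties using (any?)
open import Data.Fin.Subset using (Subset; _∩_; _∪_; ⁅_⁆; ∣_∣; ⊤)
open import Data.Fin.Subset.Properties using (_∈?_)
open import Data.List using (List; allFin; cartesianProduct; filter; length; lookup)
open import Data.List.Membership.Propositional.Properties using (∈-lookup; ∈-filter⁻)
open import Data.Nat using (ℕ; zero; suc; _≤_)
open import Data.Product using (_×_; _,_; ∃-syntax; proj₁; proj₂)
open import Data.Vec using (tabulate)
open import Relation.Binary.Construct.Closure.ReflexiveTransitive using (Star)
open import Relation.Binary.PropositionalEquality using (_≡_; _≢_; sym; subst)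
open import Relation.Nullary using (¬_)
open import Relation.Nullary.Decidable using (does; ⌊_⌋; toWitness; _×-dec_)
open import Relation.Unary using (Decidable)

-- The vertices are numbered, so that vertex sets are `Subset order`.  A Boolean
-- adjacency function rules out multiple arcs and allows digons.
record Digraph : Set where
  field
    order    : ℕ
    adj      : Fin order → Fin order → Bool
    loopless : ∀ u → ¬ T (adj u u)

  Vertex : Set
  Vertex = Fin order

  _⟶_ : Vertex → Vertex → Set
  u ⟶ v = T (adj u v)

open Digraph public using (Vertex)

⋃[_] : ∀ {n} → Subset n → (Fin n → Subset n) → Subset n
⋃[ U ] F = tabulate λ v → does (any? λ u → (u ∈? U) ×-dec (v ∈? F u))

module _ (G : Digraph) where
  open Digraph G using (order; adj; _⟶_)

  VertexSet : Set
  VertexSet = Subset order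

  N⁻ N⁺ : Vertex G → VertexSet
  N⁻ u = tabulate λ v → adj v u
  N⁺ u = tabulate λ v → adj u v

  -- N⁻[u] and N⁺[u] for a single vertex u.
  N⁻c N⁺c : Vertex G → VertexSet
  N⁻c u = ⁅ u ⁆ ∪ N⁻ u
  N⁺c u = ⁅ u ⁆ ∪ N⁺ u

  N⁻[_] N⁺[_] : VertexSet → VertexSet
  N⁻[ U ] = ⋃[ U ] N⁻c
  N⁺[ U ] = ⋃[ U ] N⁺c

  inDegree : Vertex G → ℕ
  inDegree u = ∣ N⁻ u ∣

  -- The minimum has to be attained, so a digraph without vertices has none.
  IsMinInDegree : ℕ → Set
  IsMinInDegree δ = (∃[ u ] inDegree u ≡ δ) × (∀ u → δ ≤ inDegree u)

  2-InRegular : Set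
  2-InRegular = ∀ u → inDegree u ≡ 2

  StronglyConnected : Set
  StronglyConnected = ∀ u v → Star _⟶_ u v

  IsDominating : VertexSet → Set
  IsDominating C = N⁺[ C ] ≡ ⊤

  IsIdentifyingCode : ℕ → VertexSet → Set
  IsIdentifyingCode ℓ C =
    IsDominating C ×
    (∀ X Y → X ≢ Y →
      1 ≤ ∣ X ∣ → ∣ X ∣ ≤ ℓ → 1 ≤ ∣ Y ∣ → ∣ Y ∣ ≤ ℓ →
      N⁻[ X ] ∩ C ≢ N⁻[ Y ] ∩ C)

  AdmitsIdentifyingCode : ℕ → Set
  AdmitsIdentifyingCode ℓ = ∃[ C ] IsIdentifyingCode ℓ C

module _ (D : Digraph) where
  open Digraph D using (order; adj; loopless)

  isArc? : Decidable (λ ((u , v) : Vertex D × Vertex D) → T (adj u v))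
  isArc? (u , v) = T? (adj u v)

  -- Each arc (u , v) occurs exactly once in this list; a position in the list
  -- serves as the vertex uv of the line digraph.
  arcs : List (Vertex D × Vertex D)
  arcs = filter isArc? (cartesianProduct (allFin order) (allFin order))

  tail head : Fin (length arcs) → Vertex D
  tail a = proj₁ (lookup arcs a)
  head a = proj₂ (lookup arcs a)

  isArc : ∀ a → T (adj (tail a) (head a))
  isArc a = proj₂ (∈-filter⁻ isArc? {xs = cartesianProduct (allFin order) (allFin order)} (∈-lookup a))

  L : Digraph
  L = record
    { order    = length arcs
    ; adj      = λ a b → ⌊ head a ≟ tail b ⌋
    ; loopless = λ a h≡t → loopless (head a)
        (subst (λ u → T (adj u (head a))) (sym (toWitness h≡t)) (isArc a))
    }

L^ : ℕ → Digraph → Digraph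
L^ zero    D = D
L^ (suc k) D = L (L^ k D)

{-# OPTIONS --safe #-}

-- In a line digraph two in-neighbourhoods are equal (same tail) or disjoint, and a
-- vertex is determined by its tail and head.  Suppose N⁻[{x,x'}] = N⁻[{y,y'}] and
-- x ∉ {y,y'}, say with an arc from x to y.  Then N⁻(x) is disjoint from N⁻(y), so
-- either N⁻(x) meets N⁻(y') and N⁻(x) = N⁻(y'), or N⁻(x) = {y,y'}.  Applying this
-- dichotomy to all four vertices leaves only the obstruction of (iii), which in
-- turn makes the two closed in-neighbourhoods coincide.  The obstruction forces a
-- vertex of in-degree 2, and in an iterated line digraph it forces a loop.
module Submission where

open import Defs
open import Data.Bool using (T)
open import Data.Bool.Properties using (T-≡)
open import Data.Empty using (⊥; ⊥-elim)
open import Data.Fin using (Fin; zero; suc; _≟_)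
open import Data.Fin.Properties using (any?)
open import Data.Fin.Subset
  using (Subset; inside; outside; _∈_; _⊆_; _∩_; _∪_; _-_; ⁅_⁆; ∣_∣; ⊤; Nonempty)
open import Data.Fin.Subset.Properties
open import Data.List using (List; _∷_; allFin; lookup)
import Data.List.Relation.Unary.All as All
open import Data.List.Relation.Unary.AllPairs using (_∷_)
open import Data.List.Membership.Propositional.Properties using (∈-lookup)
open import Data.List.Relation.Unary.Unique.Propositional using (Unique)
open import Data.List.Relation.Unary.Unique.Propositional.Properties
  using (allFin⁺; cartesianProduct⁺; filter⁺)
open import Data.Nat using (ℕ; suc; _+_; _≤_; s≤s; z≤n)
open import Data.Nat.Properties
  using (≤-trans; ≤-reflexive; ≤-pred; +-suc; 1+n≰n; m≤n⇒m≤1+n)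
open import Data.Product using (_×_; _,_; ∃-syntax; ∃₂; proj₁; proj₂)
open import Data.Sum as Sum using (_⊎_; inj₁; inj₂; [_,_]′)
open import Data.Vec using ([]; _∷_; tabulate)
open import Data.Vec.Properties using (lookup∘tabulate; lookup⇒[]=; []=⇒lookup)
open import Function using (_∘_)
open import Function.Bundles using (_⇔_; mk⇔; Equivalence)
open import Relation.Binary.PropositionalEquality
  using (_≡_; _≢_; refl; sym; trans; cong; cong₂; subst; module ≡-Reasoning)
open import Relation.Nullary using (¬_; yes; no; contradiction)
open import Relation.Nullary.Decidable
  using (isYes≗does; toWitness; fromWitness; _×-dec_; ¬?; decidable-stable)

-- Finite sets, pairs and cardinalities

private
  variable
    n : ℕ
    p : Subset n
    x y z : Fin n

∈-tabulate⁺ : ∀ {f} → T (f x) → x ∈ tabulate f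
∈-tabulate⁺ {x = x} {f} fx =
  lookup⇒[]= x _ (trans (lookup∘tabulate f x) (Equivalence.to T-≡ fx))

∈-tabulate⁻ : ∀ {f} → x ∈ tabulate f → T (f x)
∈-tabulate⁻ {x = x} {f} x∈ =
  Equivalence.from T-≡ (trans (sym (lookup∘tabulate f x)) ([]=⇒lookup x∈))

∈-⋃⁺ : ∀ {U : Subset n} {F} → x ∈ U → y ∈ F x → y ∈ ⋃[ U ] F
∈-⋃⁺ {x = x} {y} {U} {F} x∈U y∈Fx = ∈-tabulate⁺ {x = y}
  (subst T (isYes≗does (any? λ u → (u ∈? U) ×-dec (y ∈? F u))) (fromWitness (x , x∈U , y∈Fx)))

∈-⋃⁻ : ∀ {U : Subset n} {F} → y ∈ ⋃[ U ] F → ∃[ x ] x ∈ U × y ∈ F x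
∈-⋃⁻ {y = y} {U} {F} y∈ = toWitness
  (subst T (sym (isYes≗does (any? λ u → (u ∈? U) ×-dec (y ∈? F u)))) (∈-tabulate⁻ {x = y} y∈))

∈-pair⁺ : x ≡ y ⊎ x ≡ z → x ∈ ⁅ y ⁆ ∪ ⁅ z ⁆
∈-pair⁺ = x∈p∪q⁺ ∘ Sum.map (λ { refl → x∈⁅x⁆ _ }) (λ { refl → x∈⁅x⁆ _ })

∈-pair⁻ : ∀ y z → x ∈ ⁅ y ⁆ ∪ ⁅ z ⁆ → x ≡ y ⊎ x ≡ z
∈-pair⁻ y z = Sum.map (x∈⁅y⁆⇒x≡y y) (x∈⁅y⁆⇒x≡y z) ∘ x∈p∪q⁻ ⁅ y ⁆ ⁅ z ⁆

∈-⋃-pair⁻ : ∀ {F : Fin n → Subset n} → x ∈ ⋃[ ⁅ y ⁆ ∪ ⁅ z ⁆ ] F → x ∈ F y ⊎ x ∈ F z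
∈-⋃-pair⁻ {x = x} {y} {z} {F} x∈ with ∈-⋃⁻ {y = x} {F = F} x∈
... | u , u∈pair , x∈Fu =
  Sum.map (λ { refl → x∈Fu }) (λ { refl → x∈Fu }) (∈-pair⁻ y z u∈pair)

∣p∪q∣≤∣p∣+∣q∣ : ∀ (p q : Subset n) → ∣ p ∪ q ∣ ≤ ∣ p ∣ + ∣ q ∣
∣p∪q∣≤∣p∣+∣q∣ []            []            = z≤n
∣p∪q∣≤∣p∣+∣q∣ (outside ∷ p) (outside ∷ q) = ∣p∪q∣≤∣p∣+∣q∣ p q
∣p∪q∣≤∣p∣+∣q∣ (outside ∷ p) (inside ∷ q)  =
  ≤-trans (s≤s (∣p∪q∣≤∣p∣+∣q∣ p q)) (≤-reflexive (sym (+-suc ∣ p ∣ ∣ q ∣)))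
∣p∪q∣≤∣p∣+∣q∣ (inside ∷ p)  (outside ∷ q) = s≤s (∣p∪q∣≤∣p∣+∣q∣ p q)
∣p∪q∣≤∣p∣+∣q∣ (inside ∷ p)  (inside ∷ q)  = s≤s
  (≤-trans (m≤n⇒m≤1+n (∣p∪q∣≤∣p∣+∣q∣ p q)) (≤-reflexive (sym (+-suc ∣ p ∣ ∣ q ∣))))

∣pair∣≤2 : ∀ (x y : Fin n) → ∣ ⁅ x ⁆ ∪ ⁅ y ⁆ ∣ ≤ 2
∣pair∣≤2 x y = ≤-trans (∣p∪q∣≤∣p∣+∣q∣ ⁅ x ⁆ ⁅ y ⁆)
  (≤-reflexive (cong₂ _+_ (∣⁅x⁆∣≡1 x) (∣⁅x⁆∣≡1 y)))

1≤∣pair∣ : ∀ (x y : Fin n) → 1 ≤ ∣ ⁅ x ⁆ ∪ ⁅ y ⁆ ∣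
1≤∣pair∣ x y = ≤-trans (≤-reflexive (sym (∣⁅x⁆∣≡1 x))) (∣p∣≤∣p∪q∣ ⁅ x ⁆ ⁅ y ⁆)

2≤∣p∣⇒∃≢ : ∀ (p : Subset n) → 2 ≤ ∣ p ∣ → ∀ x → ∃[ y ] y ∈ p × y ≢ x
2≤∣p∣⇒∃≢ p 2≤∣p∣ x with any? (λ y → (y ∈? p) ×-dec ¬? (y ≟ x))
... | yes found = found
... | no  ∄     = contradiction (≤-trans 2≤∣p∣ ∣p∣≤1) 1+n≰n
  where
  p⊆⁅x⁆ : p ⊆ ⁅ x ⁆
  p⊆⁅x⁆ {y} y∈p = subst (_∈ ⁅ x ⁆)
    (sym (decidable-stable (y ≟ x) λ y≢x → ∄ (y , y∈p , y≢x))) (x∈⁅x⁆ x)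
  ∣p∣≤1 : ∣ p ∣ ≤ 1
  ∣p∣≤1 = ≤-trans (p⊆q⇒∣p∣≤∣q∣ p⊆⁅x⁆) (≤-reflexive (∣⁅x⁆∣≡1 x))

x∈p⇒1≤∣p∣ : x ∈ p → 1 ≤ ∣ p ∣
x∈p⇒1≤∣p∣ x∈p = ≤-trans (s≤s z≤n) (x∈p⇒∣p-x∣<∣p∣ x∈p)

∣p∣≤1⇒x≡y : ∀ (p : Subset n) → ∣ p ∣ ≤ 1 → x ∈ p → y ∈ p → x ≡ y
∣p∣≤1⇒x≡y {x = x} {y} p ∣p∣≤1 x∈p y∈p = decidable-stable (x ≟ y) λ x≢y →
  1+n≰n (≤-trans (x∈p⇒1≤∣p∣ (x∈p∧x≢y⇒x∈p-y x∈p x≢y))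
    (≤-pred (≤-trans (x∈p⇒∣p-x∣<∣p∣ y∈p) ∣p∣≤1)))

1≤∣p∣≤2⇒pair : ∀ (p : Subset n) → 1 ≤ ∣ p ∣ → ∣ p ∣ ≤ 2 → ∃₂ λ x y → p ≡ ⁅ x ⁆ ∪ ⁅ y ⁆
1≤∣p∣≤2⇒pair {n} p 1≤∣p∣ ∣p∣≤2 with nonempty? p
... | no p-empty = contradiction
  (≤-trans 1≤∣p∣ (≤-reflexive (trans (cong ∣_∣ (Empty-unique p-empty)) (∣⊥∣≡0 n)))) λ ()
... | yes (x , x∈p) with nonempty? (p - x)
-- A singleton becomes a pair with a repeated entry, so sizes 1 and 2 are treated alike from here
-- on.
...   | no p-x-empty = x , x , ⊆-antisym
  (λ {z} z∈p → ∈-pair⁺ (inj₁ (decidable-stable (z ≟ x)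
    λ z≢x → p-x-empty (z , x∈p∧x≢y⇒x∈p-y z∈p z≢x))))
  λ z∈ → [ (λ { refl → x∈p }) , (λ { refl → x∈p }) ]′ (∈-pair⁻ x x z∈)
...   | yes (y , y∈p-x) = x , y , ⊆-antisym p⊆pair
  λ z∈ → [ (λ { refl → x∈p }) , (λ { refl → p─q⊆p p ⁅ x ⁆ y∈p-x }) ]′ (∈-pair⁻ x y z∈)
  where
  p⊆pair : p ⊆ ⁅ x ⁆ ∪ ⁅ y ⁆
  p⊆pair {z} z∈p with z ≟ x
  ... | yes z≡x = ∈-pair⁺ (inj₁ z≡x)
  ... | no  z≢x = ∈-pair⁺ (inj₂ (∣p∣≤1⇒x≡y (p - x)
    (≤-pred (≤-trans (x∈p⇒∣p-x∣<∣p∣ x∈p) ∣p∣≤2)) (x∈p∧x≢y⇒x∈p-y z∈p z≢x) y∈p-x))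

lookup-injective : ∀ {A : Set} {xs : List A} → Unique xs →
                   ∀ {i j} → lookup xs i ≡ lookup xs j → i ≡ j
lookup-injective (_ ∷ _)     {zero}  {zero}  _  = refl
lookup-injective (x≢xs ∷ _)  {zero}  {suc j} eq = contradiction eq (All.lookup x≢xs (∈-lookup j))
lookup-injective (x≢xs ∷ _)  {suc i} {zero}  eq =
  contradiction (sym eq) (All.lookup x≢xs (∈-lookup i))
lookup-injective (_ ∷ xs!)   {suc i} {suc j} eq = cong suc (lookup-injective xs! eq)

-- Closed in-neighbourhoods and codes in an arbitrary digraph

Obstruction : Digraph → Set
Obstruction G = ∃[ x ] ∃[ y ] ∃[ x' ] ∃[ y' ]
    x' ≢ x
  × y' ≢ y
  × N⁻ G x ≡ ⁅ y ⁆ ∪ ⁅ y' ⁆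
  × N⁻ G y ≡ ⁅ x ⁆ ∪ ⁅ x' ⁆
  × Nonempty (N⁻ G x' ∩ N⁻ G y')

module _ (G : Digraph) where

  ∈-N⁻c⁺ : ∀ {u v} → v ≡ u ⊎ v ∈ N⁻ G u → v ∈ N⁻c G u
  ∈-N⁻c⁺ = x∈p∪q⁺ ∘ Sum.map₁ λ { refl → x∈⁅x⁆ _ }

  ∈-N⁻c⁻ : ∀ {u v} → v ∈ N⁻c G u → v ≡ u ⊎ v ∈ N⁻ G u
  ∈-N⁻c⁻ {u} = Sum.map₁ (x∈⁅y⁆⇒x≡y u) ∘ x∈p∪q⁻ ⁅ u ⁆ (N⁻ G u)

  ⊤-dominating : IsDominating G ⊤
  ⊤-dominating = ⊆-antisym ⊆⊤ λ {v} _ → ∈-⋃⁺ {x = v} ∈⊤ (p⊆p∪q _ (x∈⁅x⁆ v))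

  -- The whole vertex set serves as the code, so only injectivity of `N⁻[_]` on sets of size 1 or 2
  -- is left. Singletons are covered because `x` and `x'` may coincide.
  admits-if-separating :
    (∀ x x' y y' → N⁻[_] G (⁅ x ⁆ ∪ ⁅ x' ⁆) ≡ N⁻[_] G (⁅ y ⁆ ∪ ⁅ y' ⁆) →
      ⁅ x ⁆ ∪ ⁅ x' ⁆ ≡ ⁅ y ⁆ ∪ ⁅ y' ⁆) →
    AdmitsIdentifyingCode G 2
  admits-if-separating separating = ⊤ , ⊤-dominating , distinguishes
    where
    distinguishes : ∀ X Y → X ≢ Y →
      1 ≤ ∣ X ∣ → ∣ X ∣ ≤ 2 → 1 ≤ ∣ Y ∣ → ∣ Y ∣ ≤ 2 →
      N⁻[_] G X ∩ ⊤ ≢ N⁻[_] G Y ∩ ⊤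
    distinguishes X Y X≢Y 1≤X X≤2 1≤Y Y≤2 eq
      with 1≤∣p∣≤2⇒pair X 1≤X X≤2 | 1≤∣p∣≤2⇒pair Y 1≤Y Y≤2
    ... | x , x' , refl | y , y' , refl = X≢Y (separating x x' y y'
      (trans (sym (∩-identityʳ _)) (trans eq (∩-identityʳ _))))

-- Line digraphs: in-neighbourhoods and the effect of an obstruction

module _ (H : Digraph) where
  private
    G = L H
    V = Vertex G

    _⇒_ : V → V → Set
    a ⇒ b = head H a ≡ tail H b

  ∈-N⁻⁺ : ∀ {a b} → a ⇒ b → a ∈ N⁻ G b
  ∈-N⁻⁺ {a} = ∈-tabulate⁺ {x = a} ∘ fromWitness

  ∈-N⁻⁻ : ∀ {a b} → a ∈ N⁻ G b → a ⇒ b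
  ∈-N⁻⁻ {a} = toWitness ∘ ∈-tabulate⁻ {x = a}

  loop-free : ∀ {a} → ¬ a ⇒ a
  loop-free {a} = Digraph.loopless G a ∘ fromWitness

  -- The list `arcs` is filtered from a product of repetition-free lists, so no arc occurs at two
  -- positions.
  arc-≡ : ∀ {a b} → tail H a ≡ tail H b → head H a ≡ head H b → a ≡ b
  arc-≡ t≡ h≡ = lookup-injective
    (filter⁺ (isArc? H) (cartesianProduct⁺ (allFin⁺ _) (allFin⁺ _))) (cong₂ _,_ t≡ h≡)

  -- The in-neighbours of an arc depend only on its tail, so one common in-neighbour makes two
  -- in-neighbourhoods equal.
  same-N⁻ : ∀ {a b c} → a ⇒ b → a ⇒ c → tail H b ≡ tail H c
  same-N⁻ a⇒b a⇒c = trans (sym a⇒b) a⇒c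

  pair⇒ : ∀ {a b c} → N⁻ G a ≡ ⁅ b ⁆ ∪ ⁅ c ⁆ → b ⇒ a × c ⇒ a
  pair⇒ N⁻a≡ = ∈-N⁻⁻ (subst (_ ∈_) (sym N⁻a≡) (∈-pair⁺ (inj₁ refl)))
             , ∈-N⁻⁻ (subst (_ ∈_) (sym N⁻a≡) (∈-pair⁺ (inj₂ refl)))

  -- The vertices `x` and `x'` lie in N⁻(y), the set N⁻(x) is {y, y'}, and N⁻(x') is N⁻(y'). The
  -- hypotheses are symmetric under exchanging `x`, `x'` with `y`, `y'`, so the reverse inclusion is
  -- another instance.
  obstruction⇒⊆ : ∀ {x y x' y'} →
    N⁻ G x ≡ ⁅ y ⁆ ∪ ⁅ y' ⁆ → N⁻ G y ≡ ⁅ x ⁆ ∪ ⁅ x' ⁆ → N⁻ G x' ≡ N⁻ G y' →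
    N⁻[_] G (⁅ x ⁆ ∪ ⁅ x' ⁆) ⊆ N⁻[_] G (⁅ y ⁆ ∪ ⁅ y' ⁆)
  obstruction⇒⊆ {x} {y} {x'} {y'} N⁻x≡ N⁻y≡ N⁻x'≡N⁻y' {v} v∈ =
    [ [ (λ { refl → via-y (inj₂ (∈-N⁻⁺ x⇒y)) })
      , [ via-y ∘ inj₁ , via-y' ∘ inj₁ ]′ ∘ ∈-pair⁻ y y' ∘ subst (v ∈_) N⁻x≡
      ]′ ∘ ∈-N⁻c⁻ G
    , [ (λ { refl → via-y (inj₂ (∈-N⁻⁺ x'⇒y)) })
      , via-y' ∘ inj₂ ∘ subst (v ∈_) N⁻x'≡N⁻y'
      ]′ ∘ ∈-N⁻c⁻ G
    ]′ (∈-⋃-pair⁻ {x = v} {F = N⁻c G} v∈)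
    where
    x⇒y : x ⇒ y
    x⇒y = proj₁ (pair⇒ N⁻y≡)
    x'⇒y : x' ⇒ y
    x'⇒y = proj₂ (pair⇒ N⁻y≡)
    via-y : v ≡ y ⊎ v ∈ N⁻ G y → v ∈ N⁻[_] G (⁅ y ⁆ ∪ ⁅ y' ⁆)
    via-y = ∈-⋃⁺ {x = y} (∈-pair⁺ (inj₁ refl)) ∘ ∈-N⁻c⁺ G
    via-y' : v ≡ y' ⊎ v ∈ N⁻ G y' → v ∈ N⁻[_] G (⁅ y ⁆ ∪ ⁅ y' ⁆)
    via-y' = ∈-⋃⁺ {x = y'} (∈-pair⁺ (inj₂ refl)) ∘ ∈-N⁻c⁺ G

  obstruction⇒¬admits : Obstruction G → ¬ AdmitsIdentifyingCode G 2
  obstruction⇒¬admits (x , y , x' , y' , _ , _ , N⁻x≡ , N⁻y≡ , w , w∈) (C , _ , separates) =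
    separates (⁅ x ⁆ ∪ ⁅ x' ⁆) (⁅ y ⁆ ∪ ⁅ y' ⁆) X≢Y
      (1≤∣pair∣ x x') (∣pair∣≤2 x x') (1≤∣pair∣ y y') (∣pair∣≤2 y y')
      (cong (_∩ C) (⊆-antisym (obstruction⇒⊆ N⁻x≡ N⁻y≡ N⁻x'≡N⁻y')
                              (obstruction⇒⊆ N⁻y≡ N⁻x≡ (sym N⁻x'≡N⁻y'))))
    where
    N⁻x'≡N⁻y' : N⁻ G x' ≡ N⁻ G y'
    N⁻x'≡N⁻y' =
      let w∈x' , w∈y' = x∈p∩q⁻ (N⁻ G x') (N⁻ G y') w∈
          t≡          = same-N⁻ {b = x'} {y'} (∈-N⁻⁻ w∈x') (∈-N⁻⁻ w∈y')
      in ⊆-antisym (λ a∈ → ∈-N⁻⁺ (trans (∈-N⁻⁻ a∈) t≡)) (λ a∈ → ∈-N⁻⁺ (trans (∈-N⁻⁻ a∈) (sym t≡)))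
    X≢Y : ⁅ x ⁆ ∪ ⁅ x' ⁆ ≢ ⁅ y ⁆ ∪ ⁅ y' ⁆
    -- Equality would put `x` into {y, y'}, which is N⁻(x).
    X≢Y X≡Y = loop-free (∈-N⁻⁻ (subst (x ∈_) (sym N⁻x≡) (subst (x ∈_) X≡Y (∈-pair⁺ (inj₁ refl)))))

  obstruction⇒∃inDegree≤2 : Obstruction G → ∃[ x ] inDegree G x ≤ 2
  obstruction⇒∃inDegree≤2 (x , y , _ , y' , _ , _ , N⁻x≡ , _) =
    x , subst (λ S → ∣ S ∣ ≤ 2) (sym N⁻x≡) (∣pair∣≤2 y y')

  -- Separation in line digraphs of minimum in-degree at least 2

  module _ (2≤inDegree : ∀ u → 2 ≤ inDegree G u) where
    private
      _◁_ : V → V → Set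
      a ◁ b = a ≡ b ⊎ a ⇒ b

      -- This is the inclusion of N⁻[a] in N⁻[{b, c}]. Four such inclusions, two in each direction,
      -- replace an equality N⁻[{x, x'}] = N⁻[{y, y'}].
      Covered : V → V → V → Set
      Covered a b c = ∀ {v} → v ◁ a → v ◁ b ⊎ v ◁ c

    another-in-neighbour : ∀ a b → ∃[ v ] v ⇒ a × v ≢ b
    another-in-neighbour a b = let v , v∈ , v≢b = 2≤∣p∣⇒∃≢ (N⁻ G a) (2≤inDegree a) b in v , ∈-N⁻⁻ v∈ , v≢b

    -- A common in-neighbour of `a` and `b` would give them the same tail, and the arc from `a` to
    -- `b` would then be a loop at `a`. If `a` and `c` have different tails, they share no
    -- in-neighbour either. So N⁻(a) lies in {b, c}, and the in-degree bound forces equality.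
    dichotomy : ∀ {a b c} → a ⇒ b → Covered a b c →
                tail H a ≡ tail H c ⊎ (c ≢ b × N⁻ G a ≡ ⁅ b ⁆ ∪ ⁅ c ⁆)
    dichotomy {a} {b} {c} a⇒b covered with tail H a ≟ tail H c
    ... | yes t≡ = inj₁ t≡
    ... | no  t≢ = inj₂ (c≢b , ⊆-antisym (∈-pair⁺ ∘ in-pair ∘ ∈-N⁻⁻)
                                 ([ (λ { refl → ∈-N⁻⁺ b⇒a }) , (λ { refl → ∈-N⁻⁺ c⇒a }) ]′ ∘ ∈-pair⁻ b c))
      where
      in-pair : ∀ {v} → v ⇒ a → v ≡ b ⊎ v ≡ c
      in-pair v⇒a with covered (inj₂ v⇒a)
      ... | inj₁ (inj₁ v≡b) = inj₁ v≡b
      ... | inj₁ (inj₂ v⇒b) = ⊥-elim (loop-free (trans a⇒b (same-N⁻ v⇒b v⇒a)))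
      ... | inj₂ (inj₁ v≡c) = inj₂ v≡c
      ... | inj₂ (inj₂ v⇒c) = contradiction (same-N⁻ v⇒a v⇒c) t≢
      -- Used with the pair in both orders: an in-neighbour of `a` other than one entry must be the
      -- other entry.
      other : ∀ {d e} → (∀ {v} → v ⇒ a → v ≡ d ⊎ v ≡ e) → e ⇒ a × e ≢ d
      other {d} only with another-in-neighbour a d
      ... | v , v⇒a , v≢d with only v⇒a
      ...   | inj₁ v≡d  = contradiction v≡d v≢d
      ...   | inj₂ refl = v⇒a , v≢d
      c⇒a : c ⇒ a
      c⇒a = proj₁ (other in-pair)
      c≢b : c ≢ b
      c≢b = proj₂ (other in-pair)
      b⇒a : b ⇒ a
      b⇒a = proj₁ (other (Sum.swap ∘ in-pair))

    -- The in-degree bound supplies an in-neighbour of `x'`, and the common tail makes it one of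
    -- `y'` too.
    obstruction : ∀ {x y x' y'} → x' ≢ x → y' ≢ y →
      N⁻ G x ≡ ⁅ y ⁆ ∪ ⁅ y' ⁆ → N⁻ G y ≡ ⁅ x ⁆ ∪ ⁅ x' ⁆ → tail H x' ≡ tail H y' → Obstruction G
    obstruction {x} {y} {x'} {y'} x'≢x y'≢y N⁻x≡ N⁻y≡ t≡ =
      let w , w⇒x' , _ = another-in-neighbour x' x' in
      x , y , x' , y' , x'≢x , y'≢y , N⁻x≡ , N⁻y≡ , w , x∈p∩q⁺ (∈-N⁻⁺ w⇒x' , ∈-N⁻⁺ (trans w⇒x' t≡))

    -- As arcs, `y` and `y'` have the same head, so being distinct they have different tails. If
    -- `dichotomy` gives both the same alternative, their tails agree; the mixed cases are the
    -- obstruction, once with `y` and `y'` exchanged.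
    N⁻-pair⇒obstruction : ∀ {x x' y y'} → y' ≢ y → N⁻ G x ≡ ⁅ y ⁆ ∪ ⁅ y' ⁆ →
      Covered y x x' → Covered y' x x' → Obstruction G
    N⁻-pair⇒obstruction {x} {x'} {y} {y'} y'≢y N⁻x≡ cov cov'
      with pair⇒ N⁻x≡
    ... | y⇒x , y'⇒x with dichotomy y⇒x cov | dichotomy y'⇒x cov'
    ...   | inj₁ t≡             | inj₁ t'≡             =
      contradiction (arc-≡ (trans t'≡ (sym t≡)) (trans y'⇒x (sym y⇒x))) y'≢y
    ...   | inj₁ t≡             | inj₂ (x'≢x , N⁻y'≡)  =
      obstruction x'≢x (y'≢y ∘ sym) (trans N⁻x≡ (∪-comm ⁅ y ⁆ ⁅ y' ⁆)) N⁻y'≡ (sym t≡)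
    ...   | inj₂ (x'≢x , N⁻y≡)  | inj₁ t'≡             = obstruction x'≢x y'≢y N⁻x≡ N⁻y≡ (sym t'≡)
    ...   | inj₂ (_ , N⁻y≡)     | inj₂ (_ , N⁻y'≡)     =
      contradiction (arc-≡ (same-N⁻ (proj₁ (pair⇒ N⁻y'≡)) (proj₁ (pair⇒ N⁻y≡)))
                           (trans y'⇒x (sym y⇒x))) y'≢y

    -- Either N⁻(x) is {y, y'}, or `x` and `y'` have a common tail. In the second case the position
    -- of `y'` relative to `x` and `x'` is examined: `y'` = `x'` is contradictory, and an arc from
    -- `y'` to `x'` lets `x'` take over the role of `x`.
    arc⇒obstruction : ∀ {x x' y y'} → x ≢ y' → x ⇒ y →
      Covered x y y' → Covered x' y y' → Covered y x x' → Covered y' x x' → Obstruction G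
    arc⇒obstruction {x} {x'} {y} {y'} x≢y' x⇒y cov-x cov-x' cov-y cov-y' with dichotomy x⇒y cov-x
    ... | inj₂ (y'≢y , N⁻x≡) = N⁻-pair⇒obstruction y'≢y N⁻x≡ cov-y cov-y'
    ... | inj₁ tx≡ty' with cov-y' (inj₁ refl)
    ...   | inj₁ (inj₁ y'≡x)  = contradiction (sym y'≡x) x≢y'
    ...   | inj₁ (inj₂ y'⇒x)  = ⊥-elim (loop-free (trans y'⇒x tx≡ty'))
    ...   | inj₂ (inj₁ refl)  = ⊥-elim shared
      where
      impossible : ¬ y ⇒ x
      impossible y⇒x with dichotomy y⇒x cov-y
      ... | inj₁ ty≡ty'     = loop-free (trans x⇒y (trans ty≡ty' (sym tx≡ty')))
      -- Both `x` and `y'` enter `y` and they have a common tail, so they would be the same arc.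
      ... | inj₂ (_ , N⁻y≡) = x≢y' (arc-≡ tx≡ty' (trans x⇒y (sym (proj₂ (pair⇒ N⁻y≡)))))
      shared : ⊥
      shared with cov-y (inj₁ refl)
      ... | inj₁ (inj₁ refl) = loop-free x⇒y
      ... | inj₁ (inj₂ y⇒x)  = impossible y⇒x
      ... | inj₂ (inj₁ refl) = loop-free (trans x⇒y (sym tx≡ty'))
      ... | inj₂ (inj₂ y⇒y') = impossible (trans y⇒y' (sym tx≡ty'))
    ...   | inj₂ (inj₂ y'⇒x') = from-x' (cov-x' (inj₁ refl))
      where
      cov-swap : ∀ {a b c} → Covered a b c → Covered a c b
      cov-swap cov = Sum.swap ∘ cov
      tails-differ : tail H x' ≢ tail H y
      -- Otherwise `x` and `y'` would also have a common head, hence coincide.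
      tails-differ tx'≡ty = x≢y' (arc-≡ tx≡ty' (trans x⇒y (trans (sym tx'≡ty) (sym y'⇒x'))))
      from-x' : x' ◁ y ⊎ x' ◁ y' → Obstruction G
      from-x' (inj₁ (inj₁ x'≡y)) = contradiction (cong (tail H) x'≡y) tails-differ
      from-x' (inj₂ (inj₁ refl)) = ⊥-elim (loop-free y'⇒x')
      from-x' (inj₁ (inj₂ x'⇒y)) with dichotomy x'⇒y cov-x'
      ... | inj₁ t≡            = ⊥-elim (loop-free (trans y'⇒x' t≡))
      ... | inj₂ (y'≢y , N⁻x'≡) =
        N⁻-pair⇒obstruction y'≢y N⁻x'≡ (cov-swap cov-y) (cov-swap cov-y')
      from-x' (inj₂ (inj₂ x'⇒y')) with dichotomy x'⇒y' (cov-swap cov-x')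
      ... | inj₁ t≡            = contradiction t≡ tails-differ
      ... | inj₂ (y≢y' , N⁻x'≡) =
        N⁻-pair⇒obstruction y≢y' N⁻x'≡ (cov-swap cov-y') (cov-swap cov-y)

    -- As `x` lies in its own closed in-neighbourhood, a vertex `x` outside the pair has an arc to
    -- `y` or `y'`; the two cases differ by exchanging these.
    covered⇒∈ : ¬ Obstruction G → ∀ {x x' y y'} →
      Covered x y y' → Covered x' y y' → Covered y x x' → Covered y' x x' → x ∈ ⁅ y ⁆ ∪ ⁅ y' ⁆
    covered⇒∈ ¬obs {x} {x'} {y} {y'} cov-x cov-x' cov-y cov-y' with x ≟ y | x ≟ y'
    ... | yes x≡y | _        = ∈-pair⁺ (inj₁ x≡y)
    ... | no _    | yes x≡y' = ∈-pair⁺ (inj₂ x≡y')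
    ... | no x≢y  | no x≢y' with cov-x (inj₁ refl)
    ...   | inj₁ (inj₁ x≡y)  = contradiction x≡y x≢y
    ...   | inj₂ (inj₁ x≡y') = contradiction x≡y' x≢y'
    ...   | inj₁ (inj₂ x⇒y)  = contradiction (arc⇒obstruction x≢y' x⇒y cov-x cov-x' cov-y cov-y') ¬obs
    ...   | inj₂ (inj₂ x⇒y') = contradiction
      (arc⇒obstruction x≢y x⇒y' (Sum.swap ∘ cov-x) (Sum.swap ∘ cov-x') cov-y' cov-y) ¬obs

    N⁻[]-≡⇒Covered : ∀ {a y y'} X → a ∈ X → N⁻[_] G X ≡ N⁻[_] G (⁅ y ⁆ ∪ ⁅ y' ⁆) → Covered a y y'
    N⁻[]-≡⇒Covered {a} {y} {y'} X a∈X eq {v} v◁a =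
      Sum.map to-◁ to-◁ (∈-⋃-pair⁻ {x = v} {F = N⁻c G} (subst (v ∈_) eq
        (∈-⋃⁺ {x = a} {U = X} a∈X (∈-N⁻c⁺ G (Sum.map₂ ∈-N⁻⁺ v◁a)))))
      where
      to-◁ : ∀ {u} → v ∈ N⁻c G u → v ◁ u
      to-◁ = Sum.map₂ ∈-N⁻⁻ ∘ ∈-N⁻c⁻ G

    ¬obstruction⇒admits : ¬ Obstruction G → AdmitsIdentifyingCode G 2
    ¬obstruction⇒admits ¬obs = admits-if-separating G λ x x' y y' eq →
      ⊆-antisym (pair⊆ x x' y y' eq) (pair⊆ y y' x x' (sym eq))
      where
      pair⊆ : ∀ x x' y y' → N⁻[_] G (⁅ x ⁆ ∪ ⁅ x' ⁆) ≡ N⁻[_] G (⁅ y ⁆ ∪ ⁅ y' ⁆) →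
              ⁅ x ⁆ ∪ ⁅ x' ⁆ ⊆ ⁅ y ⁆ ∪ ⁅ y' ⁆
      pair⊆ x x' y y' eq z∈ =
        [ (λ { refl → covered⇒∈ ¬obs cov-x cov-x' cov-y cov-y' })
        , (λ { refl → covered⇒∈ ¬obs cov-x' cov-x (Sum.swap ∘ cov-y) (Sum.swap ∘ cov-y') })
        ]′ (∈-pair⁻ x x' z∈)
        where
        cov-x : Covered x y y'
        cov-x = N⁻[]-≡⇒Covered (⁅ x ⁆ ∪ ⁅ x' ⁆) (∈-pair⁺ (inj₁ refl)) eq
        cov-x' : Covered x' y y'
        cov-x' = N⁻[]-≡⇒Covered (⁅ x ⁆ ∪ ⁅ x' ⁆) (∈-pair⁺ (inj₂ refl)) eq
        cov-y : Covered y x x'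
        cov-y = N⁻[]-≡⇒Covered (⁅ y ⁆ ∪ ⁅ y' ⁆) (∈-pair⁺ (inj₁ refl)) (sym eq)
        cov-y' : Covered y' x x'
        cov-y' = N⁻[]-≡⇒Covered (⁅ y ⁆ ∪ ⁅ y' ⁆) (∈-pair⁺ (inj₂ refl)) (sym eq)

-- With u = head y' and v = head x', the arcs x' and y' start at a common vertex of
-- L H, so v and u have a common tail, and the arc y from v to u makes v a loop of H.
LL-¬obstruction : ∀ H → ¬ Obstruction (L (L H))
LL-¬obstruction H (x , y , x' , y' , _ , _ , N⁻x≡ , N⁻y≡ , w , w∈) = loop-free H (begin
  head H (head G x')   ≡⟨ cong (head H) x'⇒y ⟩
  head H (tail G y)    ≡⟨ arc y ⟩
  tail H (head G y)    ≡⟨ cong (tail H) (trans y⇒x (sym y'⇒x)) ⟩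
  tail H (head G y')   ≡⟨ arc y' ⟨
  head H (tail G y')   ≡⟨ cong (head H) (same-N⁻ G {b = x'} {y'} (∈-N⁻⁻ G (proj₁ w∈×)) (∈-N⁻⁻ G (proj₂ w∈×))) ⟨
  head H (tail G x')   ≡⟨ arc x' ⟩
  tail H (head G x')   ∎)
  where
  open ≡-Reasoning
  G = L H
  arc : ∀ a → head H (tail G a) ≡ tail H (head G a)
  arc a = toWitness (isArc G a)
  y⇒x : head G y ≡ tail G x
  y⇒x = proj₁ (pair⇒ G N⁻x≡)
  y'⇒x : head G y' ≡ tail G x
  y'⇒x = proj₂ (pair⇒ G N⁻x≡)
  x'⇒y : head G x' ≡ tail G y
  x'⇒y = proj₂ (pair⇒ G N⁻y≡)
  w∈× : w ∈ N⁻ (L G) x' × w ∈ N⁻ (L G) y'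
  w∈× = x∈p∩q⁻ (N⁻ (L G) x') (N⁻ (L G) y') w∈

corollary2p1 : (D : Digraph) → StronglyConnected D →
    (k : ℕ) → 1 ≤ k →
    (δ⁻ : ℕ) → IsMinInDegree (L^ k D) δ⁻ → 2 ≤ δ⁻ →
    (2 ≤ k → AdmitsIdentifyingCode (L^ k D) 2)
    × (k ≡ 1 → 3 ≤ δ⁻ → AdmitsIdentifyingCode (L D) 2)
    × (2-InRegular D →
    AdmitsIdentifyingCode (L^ k D) 2
    ⇔
    (¬ (∃[ x ] ∃[ y ] ∃[ x' ] ∃[ y' ]
    x' ≢ x
    × y' ≢ y
    × N⁻ (L^ k D) x ≡ ⁅ y ⁆ ∪ ⁅ y' ⁆
    × N⁻ (L^ k D) y ≡ ⁅ x ⁆ ∪ ⁅ x' ⁆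
    × Nonempty (N⁻ (L^ k D) x' ∩ N⁻ (L^ k D) y'))))
corollary2p1 D _ (suc k) _ δ⁻ (_ , δ⁻≤) 2≤δ⁻ =
    -- Matching on the bound exposes the exponent as m + 2, so the digraph is a double line digraph
    -- of `L^ m D`.
    (λ { (s≤s (s≤s {n = m} _)) → admits (LL-¬obstruction (L^ m D)) })
  , (λ { refl 3≤δ⁻ → admits λ obs →
         -- The first in-neighbourhood of an obstruction is a pair, so its in-degree is below 3.
         let x , ≤2 = obstruction⇒∃inDegree≤2 D obs in
         1+n≰n (≤-trans 3≤δ⁻ (≤-trans (δ⁻≤ x) ≤2)) })
  , λ _ → mk⇔ (λ code obs → obstruction⇒¬admits (L^ k D) obs code) admits
  where
  admits : ¬ Obstruction (L^ (suc k) D) → AdmitsIdentifyingCode (L^ (suc k) D) 2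
  admits = ¬obstruction⇒admits (L^ k D) λ u → ≤-trans 2≤δ⁻ (δ⁻≤ u)
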